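{- Fix a positive integer $m$. Then, as a function of $n$ (with $n\to\infty$), the domination number satisfies $\gamma(\mathcal{SR}(m,n))=\Theta(n^{m-2})$.
   Context: For positive integers $m,n$, the simplicial rook graph $\mathcal{SR}(m,n)$ is the graph whose vertices are the vectors $(a_1,\dots,a_m)\in\mathbb{N}^m$ (nonnegative integer coordinates) with $a_1+\cdots+a_m=n$, two vertices being adjacent if and only if their vectors differ in exactly two coordinates. $\gamma(G)$ denotes the domination number of a graph $G$: the minimum size of a set $D$ of vertices such that every vertex is in $D$ or adjacent to a vertex of $D$.
   Formalization: For m = 1 the claim as stated fails: the graph has a single vertex, so its domination number is 1, while n^(m-2) = 1/n tends to 0; the formal statement reads the exponent as 0 when m = 1 (giving Θ(1)) and is the literal claim for all m ≥ 2. -}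

module Defs where

open import Data.Empty using (⊥-elim)
import Data.Fin.Properties as Fin
open import Data.List using (List; []; _∷_; length; concatMap; cartesianProductWith; deduplicate; upTo)
open import Data.List.Membership.Propositional using (_∈_; lose)
open import Data.List.Membership.Propositional.Properties
  using (∈-cartesianProductWith⁺; ∈-concatMap⁺; ∈-deduplicate⁺; ∈-upTo⁺)
import Data.List.Membership.DecPropositional as DecMembership
import Data.List.Relation.Unary.All as ListAll
import Data.List.Relation.Unary.Any as ListAny
open import Data.List.Relation.Unary.Any using (here)
open import Data.List.Relation.Unary.Unique.Propositional using (Unique)
import Data.List.Relation.Unary.Unique.DecPropositional as DecUnique
open import Data.List.Relation.Unary.Unique.DecPropositional.Properties using (deduplicate-!)
open import Data.Nat using (ℕ; zero; suc; _*_; _≤_; _≥_; z≤n; s≤s)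
open import Data.Nat.Properties
  using (_≟_; ≡-irrelevant; ≤-trans; ≤-reflexive; m≤m+n; m≤n+m)
open import Data.Product using (Σ; ∃; ∃-syntax; _×_; _,_; proj₁; proj₂)
open import Data.Sum using (_⊎_; inj₁)
open import Data.Vec using (Vec; []; _∷_; lookup; sum; toList; fromList)
open import Data.Vec.Properties using (≡-dec; length-toList; toList∘fromList)
open import Data.Vec.Relation.Unary.All using (All; []; _∷_)
import Data.Vec.Relation.Unary.All as VecAll
open import Relation.Binary using (Decidable; DecidableEquality)
open import Relation.Binary.PropositionalEquality using (_≡_; _≢_; refl; sym; cong; subst; ≢-sym)
open import Relation.Nullary using (¬_; Dec; yes; no)
open import Relation.Nullary.Decidable using (map′; _×-dec_; _⊎-dec_; _→-dec_; ¬?)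
import Relation.Unary as Pred

-- A natural-number constant loses no generality over a positive real
-- one, since it may be rounded up.
_=O_ : (ℕ → ℕ) → (ℕ → ℕ) → Set
f =O g = ∃[ C ] ∃[ N ] (∀ n → n ≥ N → f n ≤ C * g n)

_=Θ_ : (ℕ → ℕ) → (ℕ → ℕ) → Set
f =Θ g = f =O g × g =O f

-- `vertices` may contain repetitions; it only witnesses finiteness.
record FiniteGraph : Set₁ where
  field
    Vertex   : Set
    _∼_      : Vertex → Vertex → Set
    ∼-sym    : ∀ {u v} → u ∼ v → v ∼ u
    ∼-irrefl : ∀ {v} → ¬ (v ∼ v)
    _∼?_     : Decidable _∼_
    _≟ᵛ_     : DecidableEquality Vertex
    vertices : List Vertex
    complete : ∀ v → v ∈ vertices

module _ (G : FiniteGraph) where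
  open FiniteGraph G

  Dominating : List Vertex → Set
  Dominating D = ∀ v → v ∈ D ⊎ (∃[ u ] (u ∈ D × v ∼ u))

  -- A set of k vertices is a repetition-free list of length k.
  HasDominatingSet : ℕ → Set
  HasDominatingSet k = ∃[ D ] (Unique D × Dominating D × length D ≡ k)

  IsDominationNumber : ℕ → Set
  IsDominationNumber k = HasDominatingSet k × (∀ j → HasDominatingSet j → k ≤ j)

least : {P : ℕ → Set} → Pred.Decidable P → ∀ n → P n →
        ∃[ k ] (P k × (∀ j → P j → k ≤ j))
least P? n p with P? 0
least P? n       p | yes p₀ = 0 , p₀ , λ _ _ → z≤n
least P? zero    p | no ¬p₀ = ⊥-elim (¬p₀ p)
least {P} P? (suc n) p | no ¬p₀ with least (λ k → P? (suc k)) n p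
... | k , pk , min = suc k , pk , min′
  where
  min′ : ∀ j → P j → suc k ≤ j
  min′ zero    q = ⊥-elim (¬p₀ q)
  min′ (suc j) q = s≤s (min j q)

tuples : {A : Set} (k : ℕ) → List A → List (Vec A k)
tuples zero    xs = [] ∷ []
tuples (suc k) xs = cartesianProductWith _∷_ xs (tuples k xs)

∈-tuples : {A : Set} {k : ℕ} {xs : List A} {v : Vec A k} → All (_∈ xs) v → v ∈ tuples k xs
∈-tuples []       = here refl
∈-tuples (p ∷ ps) = ∈-cartesianProductWith⁺ _∷_ p (∈-tuples ps)

module _ (G : FiniteGraph) where
  open FiniteGraph G
  open DecMembership _≟ᵛ_ using (_∈?_)
  open DecUnique _≟ᵛ_ using (unique?)

  dominating? : Pred.Decidable (Dominating G)
  dominating? D =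
    map′ (λ all v → ListAll.lookup all (complete v)) (λ dom → ListAll.tabulate (λ {v} _ → dom v))
      (ListAll.all? (λ v → (v ∈? D) ⊎-dec neighbour? v) vertices)
    where
    neighbour? : ∀ v → Dec (∃[ u ] (u ∈ D × v ∼ u))
    neighbour? v =
      map′ ListAny.satisfied (λ (u , p) → lose (complete u) p)
        (ListAny.any? (λ u → (u ∈? D) ×-dec (v ∼? u)) vertices)

  hasDominatingSet? : Pred.Decidable (HasDominatingSet G)
  hasDominatingSet? k =
    map′ to from
      (ListAny.any? (λ w → unique? (toList w) ×-dec dominating? (toList w)) (tuples k vertices))
    where
    Good : Vec Vertex k → Set
    Good w = Unique (toList w) × Dominating G (toList w)

    to : ListAny.Any Good (tuples k vertices) → HasDominatingSet G k
    to any with ListAny.satisfied any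
    ... | w , uniq , dom = toList w , uniq , dom , length-toList w

    from : HasDominatingSet G k → ListAny.Any Good (tuples k vertices)
    from (D , uniq , dom , refl) =
      lose (∈-tuples (VecAll.universal complete (fromList D)))
        (subst Unique D≡ uniq , subst (Dominating G) D≡ dom)
      where
      D≡ : D ≡ toList (fromList D)
      D≡ = sym (toList∘fromList D)

  dominationNumber : ∃ (IsDominationNumber G)
  dominationNumber =
    least hasDominatingSet? (length V)
      (V , deduplicate-! _≟ᵛ_ vertices , (λ v → inj₁ (∈-deduplicate⁺ _≟ᵛ_ (complete v))) , refl)
    where
    V : List Vertex
    V = deduplicate _≟ᵛ_ vertices

  γ : ℕ
  γ = proj₁ dominationNumber

  γ-isDominationNumber : IsDominationNumber G γ
  γ-isDominationNumber = proj₂ dominationNumber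

RookVertex : ℕ → ℕ → Set
RookVertex m n = Σ (Vec ℕ m) (λ a → sum a ≡ n)

DifferInExactlyTwo : ∀ {m} → Vec ℕ m → Vec ℕ m → Set
DifferInExactlyTwo a b =
  ∃[ i ] ∃[ j ] (i ≢ j × lookup a i ≢ lookup b i × lookup a j ≢ lookup b j ×
                 (∀ k → k ≢ i → k ≢ j → lookup a k ≡ lookup b k))

differInExactlyTwo? : ∀ {m} → Decidable (DifferInExactlyTwo {m})
differInExactlyTwo? a b =
  Fin.any? λ i → Fin.any? λ j →
    ¬? (i Fin.≟ j) ×-dec ¬? (lookup a i ≟ lookup b i) ×-dec ¬? (lookup a j ≟ lookup b j) ×-dec
    Fin.all? λ k → ¬? (k Fin.≟ i) →-dec (¬? (k Fin.≟ j) →-dec (lookup a k ≟ lookup b k))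

rookVertex-≡ : ∀ {m n} {u v : RookVertex m n} → proj₁ u ≡ proj₁ v → u ≡ v
rookVertex-≡ {u = a , p} {v = _ , q} refl = cong (a ,_) (≡-irrelevant p q)

withSum : ∀ {m} n → Vec ℕ m → List (RookVertex m n)
withSum n a with sum a ≟ n
... | yes p = (a , p) ∷ []
... | no  _ = []

∈-withSum : ∀ {m n} (v : RookVertex m n) → v ∈ withSum n (proj₁ v)
∈-withSum {n = n} (a , p) with sum a ≟ n
... | yes q = here (rookVertex-≡ refl)
... | no ¬q = ⊥-elim (¬q p)

rookVertices : ∀ m n → List (RookVertex m n)
rookVertices m n = concatMap (withSum n) (tuples m (upTo (suc n)))

entries≤sum : ∀ {m n} (a : Vec ℕ m) → sum a ≤ n → All (_≤ n) a
entries≤sum []      _ = []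
entries≤sum (x ∷ a) p =
  ≤-trans (m≤m+n x (sum a)) p ∷ entries≤sum a (≤-trans (m≤n+m (sum a) x) p)

∈-rookVertices : ∀ {m n} (v : RookVertex m n) → v ∈ rookVertices m n
∈-rookVertices {n = n} v@(a , p) =
  ∈-concatMap⁺ (withSum n)
    (lose (∈-tuples (VecAll.map (λ x≤n → ∈-upTo⁺ (s≤s x≤n)) (entries≤sum a (≤-reflexive p))))
          (∈-withSum v))

SR : ℕ → ℕ → FiniteGraph
SR m n = record
  { Vertex   = RookVertex m n
  ; _∼_      = λ u v → DifferInExactlyTwo (proj₁ u) (proj₁ v)
  ; ∼-sym    = λ (i , j , i≢j , pᵢ , pⱼ , eq) →
                 i , j , i≢j , ≢-sym pᵢ , ≢-sym pⱼ , λ k k≢i k≢j → sym (eq k k≢i k≢j)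
  ; ∼-irrefl = λ (_ , _ , _ , pᵢ , _) → pᵢ refl
  ; _∼?_     = λ u v → differInExactlyTwo? (proj₁ u) (proj₁ v)
  ; _≟ᵛ_     = λ u v → map′ rookVertex-≡ (cong proj₁) (≡-dec _≟_ (proj₁ u) (proj₁ v))
  ; vertices = rookVertices m n
  ; complete = ∈-rookVertices
  }

{-# OPTIONS --safe #-}

-- Vertices with first coordinate 0 dominate, since the first coordinate can be
-- moved onto the second; there are at most (n + 1)^(m - 2) of them. Conversely a
-- member u of a closed neighbourhood of v is recovered from v, the two positions
-- where they may differ and one of the two new entries, so a closed neighbourhood
-- has at most m² (n + 1) members. With q = ⌊n / (m - 1)⌋ there are at least
-- (q + 1)^(m - 1) vertices: choose all coordinates but the first in {0, …, q}.
module Submission where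

open import Defs
open import Data.Nat
  using (ℕ; _∸_; _^_; NonZero; zero; suc; _+_; _*_; _≤_; _<_; z≤n; s≤s; s≤s⁻¹; _/_; _%_)
open import Data.Nat.Properties
  using (+-assoc; +-identityʳ; +-monoˡ-≤; +-mono-≤; *-monoʳ-≤; *-comm; *-identityˡ;
         *-cancelˡ-≤; [m*n]*[o*p]≡[m*o]*[n*p]; ^-monoˡ-≤; ≤-refl; ≤-trans; ≤-reflexive; <⇒≤;
         m≤n+m; m+n∸n≡m; m∸n+n≡m; m≢1+n+m; _≟_; module ≤-Reasoning)
open import Data.Nat.DivMod using (m/n*n≤m; m≡m%n+[m/n]*n; m%n<n)
open import Data.Nat.Tactic.RingSolver using (solve-∀)
open import Data.Fin using (Fin; zero; suc)
open import Data.Fin.Properties using (injective⇒≤)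
open import Data.List using (List; []; _∷_; length; map; concatMap; cartesianProduct;
                             cartesianProductWith; deduplicate; upTo; allFin)
import Data.List as List
open import Data.List.Properties using (length-map; length-++; length-upTo; length-tabulate;
                                        length-deduplicate)
open import Data.List.Membership.Propositional using (_∈_; lose)
open import Data.List.Membership.Propositional.Properties
  using (∈-cartesianProductWith⁺; ∈-cartesianProductWith⁻; ∈-cartesianProduct⁺; ∈-concatMap⁺;
         ∈-deduplicate⁺; ∈-upTo⁺; ∈-upTo⁻; ∈-allFin; ∈-lookup; ∈-map⁺; ∈-map⁻; ∈-length)
open import Data.List.Membership.Setoid.Properties using (index-injective)
import Data.List.Relation.Unary.All as ListAll
open import Data.List.Relation.Unary.AllPairs using ([]; _∷_)
open import Data.List.Relation.Unary.Any using (here)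
open import Data.List.Relation.Unary.Unique.Propositional using (Unique)
open import Data.List.Relation.Unary.Unique.Propositional.Properties
  using (upTo⁺; map⁺; cartesianProductWith⁺)
open import Data.List.Relation.Unary.Unique.DecPropositional.Properties using (deduplicate-!)
open import Data.List.Relation.Binary.Subset.Propositional using (_⊆_)
open import Data.Product using (∃-syntax; _×_; _,_; proj₁; proj₂)
open import Data.Sum using (inj₁; inj₂)
open import Data.Vec using (Vec; []; _∷_; lookup; sum; _[_]≔_)
open import Data.Vec.Properties
  using (∷-injective; ∷-injectiveʳ; []≔-lookup; lookup∘update; lookup∘update′)
open import Data.Vec.Relation.Unary.All using (All; []; _∷_)
import Data.Vec.Relation.Unary.All as VecAll
import Data.Vec.Relation.Unary.All.Properties as VecAllₚ
import Data.Fin as Fin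
open import Function using (_∘_)
open import Relation.Binary.PropositionalEquality
  using (_≡_; _≢_; refl; sym; trans; cong; cong₂; subst; setoid; module ≡-Reasoning)
open import Relation.Nullary using (yes; no; contradiction)

-- Counting with repetition-free lists

lookup-injective : {A : Set} {xs : List A} → Unique xs →
                   ∀ i j → List.lookup xs i ≡ List.lookup xs j → i ≡ j
lookup-injective (_ ∷ _)   zero    zero    _  = refl
lookup-injective (x∉ ∷ _)  zero    (suc j) eq = contradiction eq (ListAll.lookup x∉ (∈-lookup j))
lookup-injective (x∉ ∷ _)  (suc i) zero    eq = contradiction (sym eq) (ListAll.lookup x∉ (∈-lookup i))
lookup-injective (_ ∷ xs!) (suc i) (suc j) eq = cong suc (lookup-injective xs! i j eq)

-- Pigeonhole: sending a position of `xs` to a position of the same entry in `ys` is injective,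
-- because equal images mean equal entries and `xs` repeats none.
unique-⊆⇒length-≤ : {A : Set} {xs ys : List A} → Unique xs → xs ⊆ ys → length xs ≤ length ys
unique-⊆⇒length-≤ xs! xs⊆ys = injective⇒≤ λ {i} {j} eq →
  lookup-injective xs! i j
    (index-injective (setoid _) (xs⊆ys (∈-lookup i)) (xs⊆ys (∈-lookup j)) eq)

length-cartesianProductWith : {A B C : Set} (f : A → B → C) (xs : List A) (ys : List B) →
                              length (cartesianProductWith f xs ys) ≡ length xs * length ys
length-cartesianProductWith f []       ys = refl
length-cartesianProductWith f (x ∷ xs) ys =
  trans (length-++ (map (f x) ys))
        (cong₂ _+_ (length-map (f x) ys) (length-cartesianProductWith f xs ys))

length-concatMap-≤ : {A B : Set} {f : A → List B} → (∀ x → length (f x) ≤ 1) →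
                     ∀ xs → length (concatMap f xs) ≤ length xs
length-concatMap-≤         f≤1 []       = z≤n
length-concatMap-≤ {f = f} f≤1 (x ∷ xs) =
  ≤-trans (≤-reflexive (length-++ (f x))) (+-mono-≤ (f≤1 x) (length-concatMap-≤ f≤1 xs))

module _ {A : Set} {xs : List A} where

  length-tuples : ∀ k → length (tuples k xs) ≡ length xs ^ k
  length-tuples zero    = refl
  length-tuples (suc k) =
    trans (length-cartesianProductWith _∷_ xs (tuples k xs)) (cong (length xs *_) (length-tuples k))

  tuples-! : Unique xs → ∀ k → Unique (tuples k xs)
  tuples-! xs! zero    = ListAll.[] ∷ []
  tuples-! xs! (suc k) = cartesianProductWith⁺ _∷_ ∷-injective xs! (tuples-! xs! k)

  ∈-tuples⁻ : ∀ k {v} → v ∈ tuples k xs → All (_∈ xs) v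
  ∈-tuples⁻ zero    {[]} _ = []
  ∈-tuples⁻ (suc k) v∈ with ∈-cartesianProductWith⁻ _∷_ xs (tuples k xs) v∈
  ... | _ , _ , x∈ , w∈ , refl = x∈ ∷ ∈-tuples⁻ k w∈

-- Recovering a vertex from a member of its closed neighbourhood

sum-≤ : ∀ {k q} {v : Vec ℕ k} → All (_≤ q) v → sum v ≤ k * q
sum-≤ []       = z≤n
sum-≤ (p ∷ ps) = +-mono-≤ p (sum-≤ ps)

sum-[]≔0 : ∀ {m} (v : Vec ℕ m) j → sum v ≡ lookup v j + sum (v [ j ]≔ 0)
sum-[]≔0 (x ∷ v) zero    = refl
sum-[]≔0 (x ∷ v) (suc j) = begin
  x + sum v                               ≡⟨ cong (x +_) (sum-[]≔0 v j) ⟩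
  x + (lookup v j + sum (v [ j ]≔ 0))     ≡⟨ swap x (lookup v j) _ ⟩
  lookup v j + (x + sum (v [ j ]≔ 0))     ∎
  where
  open ≡-Reasoning
  swap : ∀ a b c → a + (b + c) ≡ b + (a + c)
  swap = solve-∀

lookup-ext : ∀ {A : Set} {m} {v w : Vec A m} → (∀ k → lookup v k ≡ lookup w k) → v ≡ w
lookup-ext {v = []}    {[]}    eq = refl
lookup-ext {v = _ ∷ _} {_ ∷ _} eq = cong₂ _∷_ (eq zero) (lookup-ext (eq ∘ suc))

[]≔-cong-off : ∀ {A : Set} {m} (v w : Vec A m) j {x} →
               (∀ k → k ≢ j → lookup v k ≡ lookup w k) → v [ j ]≔ x ≡ w [ j ]≔ x
[]≔-cong-off v w j {x} eq = lookup-ext agree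
  where
  agree : ∀ k → lookup (v [ j ]≔ x) k ≡ lookup (w [ j ]≔ x) k
  agree k with k Fin.≟ j
  ... | yes refl = trans (lookup∘update j v x) (sym (lookup∘update j w x))
  ... | no  k≢j  = trans (lookup∘update′ k≢j v x) (trans (eq k k≢j) (sym (lookup∘update′ k≢j w x)))

-- The entry at `j` is chosen to bring the total to `n`. If the other entries already exceed `n`,
-- truncated subtraction gives 0 and the total is wrong; this is harmless, as the results serve only
-- as candidates in an upper count.
balance : ∀ {m} → ℕ → Vec ℕ m → Fin m → Vec ℕ m
balance n v j = v [ j ]≔ (n ∸ sum (v [ j ]≔ 0))

balance-sum : ∀ {m n} (v : Vec ℕ m) j → sum v ≡ n → balance n v j ≡ v
balance-sum {n = n} v j sum≡n = trans (cong (v [ j ]≔_) entry) ([]≔-lookup v j)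
  where
  open ≡-Reasoning
  rest = sum (v [ j ]≔ 0)
  entry : n ∸ rest ≡ lookup v j
  entry = begin
    n ∸ rest                    ≡⟨ cong (_∸ rest) (trans (sym sum≡n) (sum-[]≔0 v j)) ⟩
    lookup v j + rest ∸ rest    ≡⟨ m+n∸n≡m (lookup v j) rest ⟩
    lookup v j                  ∎

-- The old entry at `j` has no influence: it is zeroed before summing and overwritten afterwards.
balance-cong : ∀ {m n} {v w : Vec ℕ m} j →
               (∀ k → k ≢ j → lookup v k ≡ lookup w k) → balance n v j ≡ balance n w j
balance-cong {n = n} {v} {w} j eq =
  trans (cong (λ u → v [ j ]≔ (n ∸ sum u)) ([]≔-cong-off v w j eq)) ([]≔-cong-off v w j eq)

rebuild : ∀ {m} → ℕ → Vec ℕ m → Fin m × Fin m × ℕ → Vec ℕ m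
rebuild n u (i , j , x) = balance n (u [ i ]≔ x) j

-- Once entry `i` is corrected, `u` agrees with `v` away from `j`, and the sum `n` then forces the
-- entry at `j`. The case `i ≡ j` is allowed.
rebuild-≡ : ∀ {m n} (u v : Vec ℕ m) i j → sum v ≡ n →
            (∀ k → k ≢ i → k ≢ j → lookup v k ≡ lookup u k) →
            rebuild n u (i , j , lookup v i) ≡ v
rebuild-≡ u v i j sum≡n eq = trans (balance-cong j agree) (balance-sum v j sum≡n)
  where
  agree : ∀ k → k ≢ j → lookup (u [ i ]≔ lookup v i) k ≡ lookup v k
  agree k k≢j with k Fin.≟ i
  ... | yes refl = lookup∘update i u (lookup v i)
  ... | no  k≢i  = trans (lookup∘update′ k≢i u (lookup v i)) (sym (eq k k≢i k≢j))

-- Counting closed neighbourhoods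

parameters : ∀ m n → List (Fin m × Fin m × ℕ)
parameters m n = cartesianProduct (allFin m) (cartesianProduct (allFin m) (upTo (suc n)))

length-parameters : ∀ m n → length (parameters m n) ≡ m * (m * suc n)
length-parameters m n = begin
  length (parameters m n)
    ≡⟨ length-cartesianProductWith _,_ (allFin m) _ ⟩
  length (allFin m) * length (cartesianProduct (allFin m) (upTo (suc n)))
    ≡⟨ cong (length (allFin m) *_) (length-cartesianProductWith _,_ (allFin m) (upTo (suc n))) ⟩
  length (allFin m) * (length (allFin m) * length (upTo (suc n)))
    ≡⟨ cong₂ (λ a b → a * (a * b)) (length-tabulate {n = m} (λ i → i)) (length-upTo (suc n)) ⟩
  m * (m * suc n) ∎
  where open ≡-Reasoning

-- Plain vectors instead of vertices, so that reconstructions with a wrong sum may stay in the list;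
-- they only enlarge the bound.
covered : ∀ m n → List (RookVertex m n) → List (Vec ℕ m)
covered m n D = cartesianProductWith (λ u → rebuild n (proj₁ u)) D (parameters m n)

rebuild-∈-covered : ∀ {m n D} {u v : RookVertex m n} → u ∈ D → ∀ i j →
                    (∀ k → k ≢ i → k ≢ j → lookup (proj₁ v) k ≡ lookup (proj₁ u) k) →
                    proj₁ v ∈ covered m n D
rebuild-∈-covered {m} {n} {D} {u} {v , sum≡n} u∈D i j eq =
  subst (_∈ covered m n D) (rebuild-≡ (proj₁ u) v i j sum≡n eq)
    (∈-cartesianProductWith⁺ (λ u → rebuild n (proj₁ u)) u∈D
      (∈-cartesianProduct⁺ (∈-allFin i) (∈-cartesianProduct⁺ (∈-allFin j) (∈-upTo⁺ (s≤s entry≤n)))))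
  where
  entry≤n : lookup v i ≤ n
  entry≤n = VecAllₚ.lookup⁺ (entries≤sum v (≤-reflexive sum≡n)) i

∈-covered : ∀ {m n D} → Dominating (SR (suc m) n) D →
            (v : RookVertex (suc m) n) → proj₁ v ∈ covered (suc m) n D
∈-covered dom v with dom v
-- A member of `D` is rebuilt from itself, with `zero` for both positions; this is where `m` must be
-- a successor.
... | inj₁ v∈D = rebuild-∈-covered {v = v} v∈D zero zero λ _ _ _ → refl
... | inj₂ (_ , u∈D , i , j , _ , _ , _ , eq) = rebuild-∈-covered {v = v} u∈D i j eq

vertices-≤ : ∀ {m n D} {vs : List (Vec ℕ (suc m))} → Dominating (SR (suc m) n) D →
             Unique vs → (∀ {v} → v ∈ vs → sum v ≡ n) →
             length vs ≤ length D * (suc m * (suc m * suc n))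
vertices-≤ {m} {n} {D} {vs} dom vs! sums = begin
  length vs
    ≤⟨ unique-⊆⇒length-≤ vs! (λ v∈ → ∈-covered dom (_ , sums v∈)) ⟩
  length (covered (suc m) n D)
    ≡⟨ length-cartesianProductWith _ D _ ⟩
  length D * length (parameters (suc m) n)
    ≡⟨ cong (length D *_) (length-parameters (suc m) n) ⟩
  length D * (suc m * (suc m * suc n)) ∎
  where open ≤-Reasoning

-- Lower bound from a box of vertices

complement : ∀ {k} → ℕ → Vec ℕ k → Vec ℕ (suc k)
complement n v = (n ∸ sum v) ∷ v

-- The hypothesis `k * q ≤ n` keeps the subtraction in `complement` from truncating, so every tuple
-- of the box yields a vertex. Distinct tuples yield distinct vertices since the tuple survives as
-- the tail.
box-≤ : ∀ {k n q D} → Dominating (SR (suc k) n) D → k * q ≤ n →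
        suc q ^ k ≤ length D * (suc k * (suc k * suc n))
box-≤ {k} {n} {q} {D} dom kq≤n = begin
  suc q ^ k
    ≡⟨ cong (_^ k) (length-upTo (suc q)) ⟨
  length (upTo (suc q)) ^ k
    ≡⟨ length-tuples k ⟨
  length box
    ≡⟨ length-map (complement n) box ⟨
  length (map (complement n) box)
    ≤⟨ vertices-≤ dom (map⁺ ∷-injectiveʳ (tuples-! (upTo⁺ (suc q)) k)) sums ⟩
  length D * (suc k * (suc k * suc n)) ∎
  where
  open ≤-Reasoning
  box = tuples k (upTo (suc q))
  sums : ∀ {v} → v ∈ map (complement n) box → sum v ≡ n
  sums v∈ with ∈-map⁻ (complement n) v∈
  ... | t , t∈ , refl =
    m∸n+n≡m (≤-trans (sum-≤ (VecAll.map (s≤s⁻¹ ∘ ∈-upTo⁻) (∈-tuples⁻ k t∈))) kq≤n)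

^-distribʳ-* : ∀ m n k → (m * n) ^ k ≡ m ^ k * n ^ k
^-distribʳ-* m n zero    = refl
^-distribʳ-* m n (suc k) =
  trans (cong (m * n *_) (^-distribʳ-* m n k)) ([m*n]*[o*p]≡[m*o]*[n*p] m n (m ^ k) (n ^ k))

n≤m*[1+n/m] : ∀ n m .{{_ : NonZero m}} → n ≤ m * suc (n / m)
n≤m*[1+n/m] n m = begin
  n                    ≡⟨ m≡m%n+[m/n]*n n m ⟩
  n % m + n / m * m    ≤⟨ +-monoˡ-≤ (n / m * m) (<⇒≤ (m%n<n n m)) ⟩
  suc (n / m) * m      ≡⟨ *-comm (suc (n / m)) m ⟩
  m * suc (n / m)      ∎
  where open ≤-Reasoning

-- With `m = 2 + k`: the power pays for rounding in the division by `m - 1`, the square counts pairs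
-- of positions, and the 2 comes from bounding `suc N` by `N + N`.
lowerConstant : ℕ → ℕ
lowerConstant k = suc k ^ suc k * ((2 + k) * (2 + k) * 2)

-- The box has order `N ^ suc k` and a closed neighbourhood order `N`, so both sides are first
-- compared with an extra factor `N`, which is then cancelled.
dominating-≥ : ∀ k {n D} → Dominating (SR (2 + k) (suc n)) D →
               suc n ^ k ≤ lowerConstant k * length D
dominating-≥ k {n} {D} dom = *-cancelˡ-≤ N (begin
  N ^ suc k
    ≤⟨ ^-monoˡ-≤ (suc k) (n≤m*[1+n/m] N (suc k)) ⟩
  (suc k * suc q) ^ suc k
    ≡⟨ ^-distribʳ-* (suc k) (suc q) (suc k) ⟩
  suc k ^ suc k * suc q ^ suc k
    ≤⟨ *-monoʳ-≤ (suc k ^ suc k) (box-≤ dom box-fits) ⟩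
  suc k ^ suc k * (length D * ((2 + k) * ((2 + k) * suc N)))
    ≤⟨ *-monoʳ-≤ (suc k ^ suc k) (*-monoʳ-≤ (length D) (*-monoʳ-≤ (2 + k) (*-monoʳ-≤ (2 + k)
         (+-monoˡ-≤ N (s≤s (z≤n {n})))))) ⟩
  suc k ^ suc k * (length D * ((2 + k) * ((2 + k) * (N + N))))
    ≡⟨ rearrange (suc k ^ suc k) (length D) (2 + k) N ⟩
  N * (lowerConstant k * length D) ∎)
  where
  open ≤-Reasoning
  N = suc n
  q = N / suc k
  box-fits : suc k * q ≤ N
  box-fits = ≤-trans (≤-reflexive (*-comm (suc k) q)) (m/n*n≤m N (suc k))
  rearrange : ∀ c l m n → c * (l * (m * (m * (n + n)))) ≡ n * (c * (m * m * 2) * l)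
  rearrange = solve-∀

-- Domination number and dominating lists

γ-≤ : ∀ G {D} → Dominating G D → γ G ≤ length D
γ-≤ G {D} dom = ≤-trans
  (proj₂ (γ-isDominationNumber G) _ (deduplicate _≟ᵛ_ D , deduplicate-! _≟ᵛ_ D , dom′ , refl))
  (length-deduplicate _≟ᵛ_ D)
  where
  open FiniteGraph G
  dom′ : Dominating G (deduplicate _≟ᵛ_ D)
  dom′ v with dom v
  ... | inj₁ v∈D             = inj₁ (∈-deduplicate⁺ _≟ᵛ_ v∈D)
  ... | inj₂ (u , u∈D , v∼u) = inj₂ (u , ∈-deduplicate⁺ _≟ᵛ_ u∈D , v∼u)

γ-dominating : ∀ G → ∃[ D ] (Dominating G D × length D ≡ γ G)
γ-dominating G with proj₁ (γ-isDominationNumber G)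
... | D , _ , dom , length≡ = D , dom , length≡

γ-positive : ∀ G → FiniteGraph.Vertex G → 0 < γ G
γ-positive G v with γ-dominating G
... | D , dom , length≡ = subst (0 <_) length≡ 0<length
  where
  0<length : 0 < length D
  0<length with dom v
  ... | inj₁ v∈D           = ∈-length v∈D
  ... | inj₂ (_ , u∈D , _) = ∈-length u∈D

-- Upper bound from the face where the first coordinate vanishes

length-withSum : ∀ {m} n (a : Vec ℕ m) → length (withSum n a) ≤ 1
length-withSum n a with sum a ≟ n
... | yes _ = ≤-refl
... | no  _ = z≤n

faceVectors : ∀ k → ℕ → List (Vec ℕ (2 + k))
faceVectors k n = map (λ t → 0 ∷ complement n t) (tuples k (upTo (suc n)))

-- Tuples t with sum t > n give vectors of the wrong sum, which withSum drops.
face : ∀ k n → List (RookVertex (2 + k) n)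
face k n = concatMap (withSum n) (faceVectors k n)

length-face : ∀ k n → length (face k n) ≤ suc n ^ k
length-face k n = begin
  length (face k n)                   ≤⟨ length-concatMap-≤ (length-withSum n) (faceVectors k n) ⟩
  length (faceVectors k n)            ≡⟨ length-map _ (tuples k (upTo (suc n))) ⟩
  length (tuples k (upTo (suc n)))    ≡⟨ length-tuples k ⟩
  length (upTo (suc n)) ^ k           ≡⟨ cong (_^ k) (length-upTo (suc n)) ⟩
  suc n ^ k                           ∎
  where open ≤-Reasoning

-- The second entry is forced by the sum, so the tail `t` alone determines the vertex.
∈-face : ∀ {k n} (v : RookVertex (2 + k) n) → lookup (proj₁ v) zero ≡ 0 → v ∈ face k n
∈-face {k} {n} v@(.0 ∷ x ∷ t , sum≡n) refl =
  ∈-concatMap⁺ (withSum n) (lose v∈ (∈-withSum v))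
  where
  entry : n ∸ sum t ≡ x
  entry = trans (cong (_∸ sum t) (sym sum≡n)) (m+n∸n≡m x (sum t))
  t∈ : t ∈ tuples k (upTo (suc n))
  t∈ = ∈-tuples (VecAll.map (∈-upTo⁺ ∘ s≤s)
         (entries≤sum t (≤-trans (m≤n+m (sum t) x) (≤-reflexive sum≡n))))
  v∈ : 0 ∷ x ∷ t ∈ faceVectors k n
  v∈ = subst (λ y → 0 ∷ y ∷ t ∈ faceVectors k n) entry (∈-map⁺ _ t∈)

face-dominating : ∀ k n → Dominating (SR (2 + k) n) (face k n)
face-dominating k n v@(zero  ∷ x ∷ t , _)     = inj₁ (∈-face v refl)
face-dominating k n v@(suc y ∷ x ∷ t , sum≡n) =
  -- Moving the positive amount `suc y` strictly changes both coordinates, as adjacency demands.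
  inj₂ (u , ∈-face u refl , zero , suc zero , (λ ()) , (λ ()) , m≢1+n+m x , agree)
  where
  u : RookVertex (2 + k) n
  u = 0 ∷ suc y + x ∷ t , trans (+-assoc (suc y) x (sum t)) sum≡n
  agree : ∀ i → i ≢ zero → i ≢ suc zero → lookup (proj₁ v) i ≡ lookup (proj₁ u) i
  agree zero          i≢0 _   = contradiction refl i≢0
  agree (suc zero)    _   i≢1 = contradiction refl i≢1
  agree (suc (suc i)) _   _   = refl

-- Both bounds for the domination number

γ-SR-≥ : ∀ k n → suc n ^ k ≤ lowerConstant k * γ (SR (2 + k) (suc n))
γ-SR-≥ k n with γ-dominating (SR (2 + k) (suc n))
... | D , dom , length≡ =
  subst (λ l → suc n ^ k ≤ lowerConstant k * l) length≡ (dominating-≥ k dom)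

γ-SR-≤ : ∀ k n → γ (SR (2 + k) (suc n)) ≤ 2 ^ k * suc n ^ k
γ-SR-≤ k n = begin
  γ (SR (2 + k) (suc n))       ≤⟨ γ-≤ (SR (2 + k) (suc n)) (face-dominating k (suc n)) ⟩
  length (face k (suc n))      ≤⟨ length-face k (suc n) ⟩
  -- Doubling the positive number `suc n` absorbs the extra 1 and produces the constant `2 ^ k`.
  suc (suc n) ^ k              ≤⟨ ^-monoˡ-≤ k (s≤s (m≤n+m (suc n) n)) ⟩
  (suc n + suc n) ^ k          ≡⟨ cong (λ x → (suc n + x) ^ k) (+-identityʳ (suc n)) ⟨
  (2 * suc n) ^ k              ≡⟨ ^-distribʳ-* 2 (suc n) k ⟩
  2 ^ k * suc n ^ k            ∎
  where open ≤-Reasoning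

γ-SR₁ : ∀ n → γ (SR 1 n) ≤ 1
γ-SR₁ n = γ-≤ (SR 1 n) {(n ∷ [] , +-identityʳ n) ∷ []} dom
  where
  dom : Dominating (SR 1 n) ((n ∷ [] , +-identityʳ n) ∷ [])
  dom (x ∷ [] , sum≡n) = inj₁ (here (rookVertex-≡ (cong (_∷ []) (trans (sym (+-identityʳ x)) sum≡n))))

theorem2 : ∀ (m : ℕ) .{{_ : NonZero m}} → (λ n → γ (SR m n)) =Θ (λ n → n ^ (m ∸ 2))
theorem2 (suc zero) =
  -- For `m = 1` the exponent `1 ∸ 2` truncates to 0, so the comparison function is constantly 1,
  -- and the single vertex gives domination number 1.
  (1 , 0 , λ n _ → γ-SR₁ n) ,
  (1 , 0 , λ n _ → ≤-trans (γ-positive (SR 1 n) (n ∷ [] , +-identityʳ n))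
                           (≤-reflexive (sym (*-identityˡ _))))
theorem2 (suc (suc k)) =
  -- The threshold 1 excludes `n = 0`, where `0 ^ k` vanishes for positive `k` although the
  -- domination number is positive.
  (2 ^ k , 1 , λ { (suc n) _ → γ-SR-≤ k n }) ,
  (lowerConstant k , 1 , λ { (suc n) _ → γ-SR-≥ k n })
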